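{- Let $m\le n$ be positive integers. If $m,n\ge 4$, or if $m\ge 3$ and $n\ge 5$, then the complete bipartite graph $K_{m,n}$ is not a weak unit rectangle visibility graph.
   Context: A finite simple graph $G$ is a weak unit rectangle visibility graph if its vertices $v$ can be represented by closed unit squares $S_v$ in the plane with sides parallel to the coordinate axes and with pairwise disjoint interiors (squares may touch along their boundaries), in such a way that whenever two vertices $v,w$ are adjacent there is an unobstructed non-degenerate (positive width) horizontal or vertical band of visibility joining $S_v$ and $S_w$. Here a horizontal band of visibility joining $S_v$ and $S_w$ is given by an open interval $I$ of positive length such that for every $y_0\in I$ the line $y=y_0$ meets the interiors of both $S_v$ and $S_w$, and the part of this line between $S_v$ and $S_w$ (possibly a single point if the squares touch) meets the interior of no other square of the representation; vertical bands are defined analogously with the roles of $x$ and $y$ exchanged. -}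

module Defs where

open import Data.Empty using (⊥)
open import Data.Fin using (Fin)
open import Data.Fin.Properties using (+↔⊎)
open import Data.Nat as ℕ using (ℕ)
open import Data.Product using (Σ-syntax; ∃; ∃-syntax; _×_; _,_)
open import Data.Rational using (ℚ; 0ℚ; 1ℚ; _+_; _-_; -_) renaming (_<_ to _<ℚ_)
open import Data.Rational.Properties
  using (+-monoˡ-<; +-assoc; +-inverseˡ; +-inverseʳ; +-identityʳ)
open import Data.Sum using (_⊎_; inj₁; inj₂)
open import Data.Unit using (⊤)
open import Function using (_↔_; _∘_)
open import Function.Bundles using (_⇔_; mk⇔; Equivalence)
open import Function.Properties.Inverse using (↔-sym)
open import Relation.Binary.PropositionalEquality
  using (_≡_; _≢_; sym; trans; cong; subst)
open import Relation.Nullary using (¬_)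

------------------------------------------------------------------------
-- Real numbers as (located) Dedekind cuts of rationals.  Lower q means
-- q < x and Upper q means x < q.  Equality of reals is never needed.

record ℝ : Set₁ where
  field
    Lower Upper    : ℚ → Set
    lowerInhabited : ∃ Lower
    upperInhabited : ∃ Upper
    lowerRounded   : ∀ q → Lower q ⇔ (∃[ r ] (q <ℚ r × Lower r))
    upperRounded   : ∀ q → Upper q ⇔ (∃[ r ] (r <ℚ q × Upper r))
    disjoint       : ∀ q → ¬ (Lower q × Upper q)
    located        : ∀ q r → q <ℚ r → Lower q ⊎ Upper r

open ℝ public

infix 4 _<_ _≤_

_<_ : ℝ → ℝ → Set
x < y = ∃[ q ] (Upper x q × Lower y q)

_≤_ : ℝ → ℝ → Set
x ≤ y = ¬ (y < x)

private
  add-sub : ∀ p c → (p + c) - c ≡ p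
  add-sub p c = trans (+-assoc p c (- c))
    (trans (cong (p +_) (+-inverseʳ c)) (+-identityʳ p))

  sub-add : ∀ p c → (p - c) + c ≡ p
  sub-add p c = trans (+-assoc p (- c) c)
    (trans (cong (p +_) (+-inverseˡ c)) (+-identityʳ p))

-- Only sums of a real and a rational are needed: q < x + c iff q - c < x.

infixl 6 _⊕_

_⊕_ : ℝ → ℚ → ℝ
Lower (x ⊕ c) q = Lower x (q - c)
Upper (x ⊕ c) q = Upper x (q - c)
lowerInhabited (x ⊕ c) with lowerInhabited x
... | q , l = q + c , subst (Lower x) (sym (add-sub q c)) l
upperInhabited (x ⊕ c) with upperInhabited x
... | q , u = q + c , subst (Upper x) (sym (add-sub q c)) u
lowerRounded (x ⊕ c) q = mk⇔ to from
  where
  to : Lower x (q - c) → ∃[ r ] (q <ℚ r × Lower x (r - c))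
  to l with Equivalence.to (lowerRounded x (q - c)) l
  ... | r , q-c<r , l′ =
    r + c , subst (_<ℚ r + c) (sub-add q c) (+-monoˡ-< c q-c<r)
          , subst (Lower x) (sym (add-sub r c)) l′
  from : ∃[ r ] (q <ℚ r × Lower x (r - c)) → Lower x (q - c)
  from (r , q<r , l) =
    Equivalence.from (lowerRounded x (q - c)) (r - c , +-monoˡ-< (- c) q<r , l)
upperRounded (x ⊕ c) q = mk⇔ to from
  where
  to : Upper x (q - c) → ∃[ r ] (r <ℚ q × Upper x (r - c))
  to u with Equivalence.to (upperRounded x (q - c)) u
  ... | r , r<q-c , u′ =
    r + c , subst (r + c <ℚ_) (sub-add q c) (+-monoˡ-< c r<q-c)
          , subst (Upper x) (sym (add-sub r c)) u′
  from : ∃[ r ] (r <ℚ q × Upper x (r - c)) → Upper x (q - c)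
  from (r , r<q , u) =
    Equivalence.from (upperRounded x (q - c)) (r - c , +-monoˡ-< (- c) r<q , u)
disjoint (x ⊕ c) q = disjoint x (q - c)
located (x ⊕ c) q r q<r = located x (q - c) (r - c) (+-monoˡ-< (- c) q<r)

------------------------------------------------------------------------
-- Finite simple graphs

record FiniteSimpleGraph : Set₁ where
  field
    Vertex     : Set
    order      : ℕ
    enumerate  : Vertex ↔ Fin order
    Adj        : Vertex → Vertex → Set
    adj-sym    : ∀ {v w} → Adj v w → Adj w v
    adj-irrefl : ∀ {v} → ¬ Adj v v

K : ℕ → ℕ → FiniteSimpleGraph
K m n = record
  { Vertex     = Fin m ⊎ Fin n
  ; order      = m ℕ.+ n
  ; enumerate  = ↔-sym +↔⊎
  ; Adj        = Adj
  ; adj-sym    = λ {v} {w} → adj-sym v w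
  ; adj-irrefl = λ {v} → adj-irrefl v
  }
  where
  Adj : Fin m ⊎ Fin n → Fin m ⊎ Fin n → Set
  Adj (inj₁ _) (inj₁ _) = ⊥
  Adj (inj₁ _) (inj₂ _) = ⊤
  Adj (inj₂ _) (inj₁ _) = ⊤
  Adj (inj₂ _) (inj₂ _) = ⊥

  adj-sym : ∀ v w → Adj v w → Adj w v
  adj-sym (inj₁ _) (inj₂ _) a = a
  adj-sym (inj₂ _) (inj₁ _) a = a

  adj-irrefl : ∀ v → ¬ Adj v v
  adj-irrefl (inj₁ _) ()
  adj-irrefl (inj₂ _) ()

------------------------------------------------------------------------
-- Axis-parallel closed unit squares in the plane

Point : Set₁
Point = ℝ × ℝ

-- The square [left , left + 1] × [bottom , bottom + 1].

record UnitSquare : Set₁ where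
  constructor square
  field
    left bottom : ℝ

  right top : ℝ
  right = left ⊕ 1ℚ
  top   = bottom ⊕ 1ℚ

open UnitSquare public

_∈Interior_ : Point → UnitSquare → Set
(x , y) ∈Interior s = (left s < x × x < right s) × (bottom s < y × y < top s)

transpose : UnitSquare → UnitSquare
transpose (square a b) = square b a

-- For squares s and t with disjoint interiors whose interiors both meet
-- a common horizontal line, one lies to the left of the other, and the
-- closed part of the line between them is { x | BetweenX s t x }
-- (a single point if the squares touch).

BetweenX : UnitSquare → UnitSquare → ℝ → Set
BetweenX s t x = (right s ≤ x × x ≤ left t) ⊎ (right t ≤ x × x ≤ left s)

LineMeetsInterior : ℝ → UnitSquare → Set₁
LineMeetsInterior y₀ s = Σ[ x ∈ ℝ ] ((x , y₀) ∈Interior s)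

module _ {V : Set} where

  DisjointInteriors : (V → UnitSquare) → Set₁
  DisjointInteriors S =
    ∀ v w → v ≢ w → ¬ (Σ[ p ∈ Point ] (p ∈Interior S v × p ∈Interior S w))

  HorizontalBand : (V → UnitSquare) → V → V → Set₁
  HorizontalBand S v w =
    Σ[ a ∈ ℝ ] Σ[ b ∈ ℝ ] (a < b ×
      (∀ y₀ → a < y₀ → y₀ < b →
        LineMeetsInterior y₀ (S v) × LineMeetsInterior y₀ (S w) ×
        (∀ u → u ≢ v → u ≢ w →
          ∀ x → BetweenX (S v) (S w) x → ¬ ((x , y₀) ∈Interior S u))))

  -- Exchanging the roles of x and y.

  VerticalBand : (V → UnitSquare) → V → V → Set₁
  VerticalBand S = HorizontalBand (transpose ∘ S)

  Visible : (V → UnitSquare) → V → V → Set₁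
  Visible S v w = HorizontalBand S v w ⊎ VerticalBand S v w

-- "Weak": adjacent vertices must see each other, but vertices that see each
-- other need not be adjacent.

IsWeakURVG : FiniteSimpleGraph → Set₁
IsWeakURVG G =
  Σ[ S ∈ (Vertex → UnitSquare) ]
    (DisjointInteriors S × (∀ v w → Adj v w → Visible S v w))
  where open FiniteSimpleGraph G

{-# OPTIONS --safe #-}

-- In a representation of K m n every edge looks left, right, up or down, which gives an m × n
-- table of directions.  Three kinds of subtables cannot occur.  First, two squares do not both
-- see two others in the same direction.  Second, a closed walk a b a′ b′ of edges does not go
-- in some direction d twice without ever going in the opposite direction: a step in direction
-- d advances by at least 1 along d, and a perpendicular step retreats by less than 1.  Third,
-- if p sees three squares in direction d and q sees them in a perpendicular direction e, then
-- no square except p sees each of them in direction d or in the direction opposite to e.  An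
-- exhaustive search shows that every 3 × 5 and every 4 × 4 table contains one of these.
--
-- Since the claim is a negation, the real coordinates enter only through the relations
-- x ≤ y + c, which are negations and so admit arguments by contradiction.

module Submission where

open import Defs renaming (_<_ to _<ᴿ_; _≤_ to _≤ᴿ_)
open import Data.Bool using (Bool; true; false; not; _∧_; _∨_; T)
open import Data.Bool.ListAction using (any; all)
open import Data.Bool.Properties using (T-∧; T-∨; T-≡)
open import Data.Empty using (⊥; ⊥-elim)
open import Data.Fin using (Fin; zero; suc; inject≤)
open import Data.Fin.Properties as Fin using (inject≤-injective)
open import Data.Integer as ℤ using (+_; -[1+_])
import Data.Integer.Properties as ℤ
import Data.Integer.Solver as ℤ-Solver
open import Data.List using (List; []; _∷_; allFin; filterᵇ; cartesianProductWith)
open import Data.List.Membership.Propositional using (_∈_)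
open import Data.List.Membership.Propositional.Properties using (∈-filter⁺; ∈-cartesianProductWith⁺)
import Data.List.Relation.Unary.All as All
import Data.List.Relation.Unary.All.Properties as All
open import Data.List.Relation.Unary.Any using (here; there; satisfied)
import Data.List.Relation.Unary.Any.Properties as Any
open import Data.Nat as ℕ using (ℕ; zero; suc; _≤_; _<_)
import Data.Nat.Properties as ℕ
open import Data.Product using (∃; ∃-syntax; Σ-syntax; _×_; _,_; proj₁; proj₂; swap)
open import Data.Rational using (ℚ; mkℚ; 0ℚ; 1ℚ; ½; _+_; _-_; -_; toℚᵘ) renaming (_<_ to _<ℚ_)
import Data.Rational.Properties as ℚ
open import Data.Rational.Solver using (module +-*-Solver)
open import Data.Rational.Unnormalised using (mkℚᵘ; *≡*; *<*) renaming (_≃_ to _≃ᵘ_)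
import Data.Rational.Unnormalised.Properties as ℚᵘ
open import Data.Sum as Sum using (_⊎_; inj₁; inj₂)
open import Data.Sum.Properties using (inj₁-injective; inj₂-injective)
open import Data.Unit using (tt)
open import Data.Vec as Vec using (Vec; []; _∷_; lookup)
import Data.Vec.Membership.Propositional as VMem
open import Data.Vec.Properties using (lookup-zip; lookup-allFin)
open import Data.Vec.Relation.Unary.All as VAll using ([]; _∷_)
import Data.Vec.Relation.Unary.All.Properties as VAll
import Data.Vec.Relation.Unary.Any as VAny
import Data.Vec.Relation.Unary.Any.Properties as VAny
open import Data.Vec.Relation.Unary.Unique.Propositional using (Unique; []; _∷_)
open import Data.Vec.Relation.Unary.Unique.Propositional.Properties using (lookup-injective; tabulate⁺)
open import Function using (_∘_; Injective)
open import Function.Bundles using (Equivalence; mk⇔)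
open import Relation.Binary.Definitions using (tri<; tri≈; tri>)
open import Relation.Binary.PropositionalEquality
  using (_≡_; _≢_; refl; sym; trans; cong; subst; subst₂; ≢-sym)
open import Relation.Nullary using (¬_)
open import Relation.Nullary.Decidable using (⌊_⌋; toWitnessFalse; T?)

-- Lines of sight between unit squares

-- X c x y reads "x ≤ y + c along X".
Comparison : Set₁
Comparison = ℚ → ℝ → ℝ → Set

reverse : Comparison → Comparison
reverse X c x y = X c y x

-- In the geometric lemmas the offsets are closed rationals, so the offset of a chain of
-- inequalities is found by computation.
record IsLine (X : Comparison) : Set₁ where
  field
    ≤-refl   : ∀ {x} → X 0ℚ x x
    ≤-trans  : ∀ {c d x y z} → X c x y → X d y z → X (c + d) x z
    ≤-total  : ∀ {c x y} → ¬ X c x y → X (- c) y x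
    ≤-irrefl : ∀ {x} → ¬ X (- 1ℚ) x x

  ≰⇒≥ : ∀ {x y} → ¬ X 0ℚ x y → X 0ℚ y x
  ≰⇒≥ = ≤-total

  sep⇒≤ : ∀ {x y} → X (- 1ℚ) x y → X 0ℚ x y
  sep⇒≤ p = ≤-trans p (≤-total ≤-irrefl)

  sep⇒< : ∀ {x y} → X (- 1ℚ) x y → ¬ X 0ℚ y x
  sep⇒< p q = ≤-irrefl (≤-trans p q)

  no-cycle-adjacent : ∀ {a b c d} → X (- 1ℚ) a b → X (- 1ℚ) b c →
                      ¬ X (- 1ℚ) d c → ¬ X (- 1ℚ) a d → ⊥
  no-cycle-adjacent ab bc cd da = da (≤-trans ab (≤-trans bc (≤-total cd)))

  no-cycle-alternate : ∀ {a b c d} → X (- 1ℚ) a b → ¬ X (- 1ℚ) c b →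
                       X (- 1ℚ) c d → ¬ X (- 1ℚ) a d → ⊥
  no-cycle-alternate ab bc cd da = da (≤-trans ab (≤-trans (≤-total bc) cd))

open IsLine

reverse-isLine : ∀ {X} → IsLine X → IsLine (reverse X)
reverse-isLine isX .≤-refl = ≤-refl isX
reverse-isLine {X} isX .≤-trans {c} {d} p q =
  subst (λ e → X e _ _) (ℚ.+-comm d c) (≤-trans isX q p)
reverse-isLine isX .≤-total = ≤-total isX
reverse-isLine isX .≤-irrefl = ≤-irrefl isX

Meets : Comparison → ℝ → ℝ → Set
Meets Y x p = ¬ Y (- ½) x p × ¬ Y (- ½) p x

-- A sight of w from v, where w lies ahead of v along X and ray is the Y-coordinate of the
-- line of sight minus ½: the line meets the interior of the square u iff |g u − ray| < ½,
-- which is symmetric under reversing Y.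
record Sight {V : Set} (X Y : Comparison) (f g : V → ℝ) (v w : V) : Set₁ where
  field
    ahead  : X (- 1ℚ) (f v) (f w)
    ray    : ℝ
    meetsˡ : Meets Y (g v) ray
    meetsʳ : Meets Y (g w) ray
    clear  : ∀ u → ¬ X 0ℚ (f u) (f v) → ¬ X 0ℚ (f w) (f u) →
             ¬ (Y ½ (g u) ray × Y ½ ray (g u))

open Sight

-- The disjunction of the four possible separations is not constructively available for reals, so
-- its double negation is used.
record Apart {V : Set} (X Y : Comparison) (f g : V → ℝ) (v w : V) : Set where
  field
    separated : ¬ X (- 1ℚ) (f v) (f w) → ¬ X (- 1ℚ) (f w) (f v) →
                ¬ Y (- 1ℚ) (g v) (g w) → ¬ Y (- 1ℚ) (g w) (g v) → ⊥

open Apart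

module _ {V : Set} {X Y : Comparison} {f g : V → ℝ} where

  mirror : ∀ {v w} → Sight X Y f g v w → Sight X (reverse Y) f g v w
  mirror s .ahead  = ahead s
  mirror s .ray    = ray s
  mirror s .meetsˡ = swap (meetsˡ s)
  mirror s .meetsʳ = swap (meetsʳ s)
  mirror s .clear u p q h = clear s u p q (swap h)

  backwards : ∀ {v w} → Sight X Y f g v w → Sight (reverse X) Y f g w v
  backwards s .ahead  = ahead s
  backwards s .ray    = ray s
  backwards s .meetsˡ = meetsʳ s
  backwards s .meetsʳ = meetsˡ s
  backwards s .clear u p q h = clear s u q p h

  Apart-sym : ∀ {v w} → Apart X Y f g v w → Apart X Y f g w v
  Apart-sym ap .separated a b c d = separated ap b a d c

  Apart-reverseˡ : ∀ {v w} → Apart X Y f g v w → Apart (reverse X) Y f g v w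
  Apart-reverseˡ ap .separated a b c d = separated ap b a c d

  Apart-reverseʳ : ∀ {v w} → Apart X Y f g v w → Apart X (reverse Y) f g v w
  Apart-reverseʳ ap .separated a b c d = separated ap a b d c

  Apart-swap : ∀ {v w} → Apart X Y f g v w → Apart Y X g f v w
  Apart-swap ap .separated a b c d = separated ap c d a b

  no-return : IsLine X → ∀ {v w} → Sight X Y f g v w → ¬ X (- 1ℚ) (f w) (f v)
  no-return isX s p = sep⇒< isX p (sep⇒≤ isX (ahead s))

  module _ (isX : IsLine X) (isY : IsLine Y) where

    -- Both `g v` and `g w` are less than ½ away from the ray.
    near : ∀ {v w} → Sight X Y f g v w → ¬ Y (- 1ℚ) (g v) (g w)
    near s p = proj₁ (meetsˡ s) (≤-trans isY p (≤-total isY (proj₂ (meetsʳ s))))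

    near′ : ∀ {v w} → Sight X Y f g v w → ¬ Y (- 1ℚ) (g w) (g v)
    near′ s p = proj₁ (meetsʳ s) (≤-trans isY p (≤-total isY (proj₂ (meetsˡ s))))

    -- The line of sight to k must pass i, and cannot pass it on the side away from k.
    peek : ∀ {v i k} → Sight X Y f g v i → Sight X Y f g v k →
           ¬ X 0ℚ (f k) (f i) → Y 0ℚ (g i) (g k) → ¬ Y 0ℚ (g v) (g i)
    peek {i = i} si sk i<k i≤k v≤i = clear sk i (sep⇒< isX (ahead si)) i<k
      ( ≤-trans isY i≤k (≤-total isY (proj₂ (meetsʳ sk)))
      , ≤-trans isY (≤-total isY (proj₁ (meetsˡ sk))) v≤i )

    -- On the same side of v, i and j overlap along Y, so one is behind the other and
    -- is seen past it.
    same-side : ∀ {v i j} → Sight X Y f g v i → Sight X Y f g v j → Apart X Y f g i j →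
                Y 0ℚ (g v) (g i) → Y 0ℚ (g v) (g j) →
                (X (- 1ℚ) (f i) (f j) → ¬ Y 0ℚ (g i) (g j) → ⊥) →
                (X (- 1ℚ) (f j) (f i) → ¬ Y 0ℚ (g j) (g i) → ⊥) → ⊥
    same-side si sj ap v≤i v≤j ij ji = separated ap
      (λ x → ij x (λ y → peek si sj (sep⇒< isX x) y v≤i))
      (λ x → ji x (λ y → peek sj si (sep⇒< isX x) y v≤j))
      (λ y → near sj (≤-trans isY v≤i y))
      (λ y → near si (≤-trans isY v≤j y))

-- Two squares seeing two others in the same direction

module _ {V : Set} {X Y : Comparison} (isX : IsLine X) (isY : IsLine Y) {f g : V → ℝ} where

  private
    X⁻ : IsLine (reverse X)
    X⁻ = reverse-isLine isX
    Y⁻ : IsLine (reverse Y)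
    Y⁻ = reverse-isLine isY

  -- `g m` is below `p + ½` and `g n` is above it, so the farther square `m` is the lower one, and
  -- `peek` applies upside down.
  overhang : ∀ {v n m p} → Sight X Y f g v n → Sight X Y f g v m → ¬ X 0ℚ (f m) (f n) →
             Meets Y (g m) p → ¬ Y ½ (g n) p → ¬ Y 0ℚ (g n) (g v)
  overhang sn sm n<m m∋p p<n = peek isX Y⁻ (mirror sn) (mirror sm) n<m
    (≤-trans isY (≤-total isY (proj₂ m∋p)) (≤-total isY p<n))

  module _ {a a′ b b′ : V}
           (a′b : Sight X Y f g a′ b) (ab : Sight X Y f g a b)
           (a′b′ : Sight X Y f g a′ b′) (ab′ : Sight X Y f g a b′) where

    -- Suppose that `a` lay wholly above the ray from `a′` to `b′`. As `b` sees `a′` past `a`, it is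
    -- lower than `a`; as `a` sees `b′` past `b`, it follows that `b` is not wholly above the ray;
    -- and being close to `a`, it is not wholly below. So `b` blocks the ray.
    not-above : ¬ X 0ℚ (f a) (f a′) → ¬ X 0ℚ (f b′) (f b) → ¬ ¬ Y ½ (g a) (ray a′b′)
    not-above a′<a b<b′ p<a =
      ¬¬b≤p λ b≤p → ¬¬p≤b λ p≤b →
      clear a′b′ b (sep⇒< isX (ahead a′b)) b<b′ (b≤p , p≤b)
      where
      b<a : ¬ Y 0ℚ (g a) (g b)
      b<a = peek X⁻ Y⁻ (mirror (backwards ab)) (mirror (backwards a′b)) a′<a
              (≤-trans isY (≤-total isY (proj₂ (meetsˡ a′b′))) (≤-total isY p<a))
      ¬¬b≤p : ¬ ¬ Y ½ (g b) (ray a′b′)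
      ¬¬b≤p p<b = overhang ab ab′ b<b′ (meetsʳ a′b′) p<b (≤-total isY b<a)
      ¬¬p≤b : ¬ ¬ Y ½ (ray a′b′) (g b)
      ¬¬p≤b b<p = near′ isX isY ab (≤-trans isY (≤-total isY b<p) (≤-total isY p<a))

    -- If `b′` were a unit above `b`, then `a`, which sees both, would lie between them in height.
    -- It would hide `a′` from `b′` if `a′` is no higher than `a`, and from `b` if `a′` is no lower.
    split : ¬ X 0ℚ (f a) (f a′) → ¬ Y (- 1ℚ) (g b) (g b′)
    split a′<a b<b′ = a≰a′ (≤-total isY a′≰a)
      where
      a′≰a : ¬ Y 0ℚ (g a′) (g a)
      a′≰a h = peek X⁻ Y⁻ (mirror (backwards ab′)) (mirror (backwards a′b′)) a′<a h
        (≤-trans isY (≤-total isY (near′ isX isY ab)) b<b′)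
      a≰a′ : ¬ Y 0ℚ (g a) (g a′)
      a≰a′ h = peek X⁻ isY (backwards ab) (backwards a′b) a′<a h
        (≤-trans isY b<b′ (≤-total isY (near isX isY ab′)))

module _ {V : Set} {X Y : Comparison} (isX : IsLine X) (isY : IsLine Y) {f g : V → ℝ} where

  private
    X⁻ : IsLine (reverse X)
    X⁻ = reverse-isLine isX
    Y⁻ : IsLine (reverse Y)
    Y⁻ = reverse-isLine isY

  module _ {a a′ b b′ : V}
           (a′b : Sight X Y f g a′ b) (ab : Sight X Y f g a b)
           (a′b′ : Sight X Y f g a′ b′) (ab′ : Sight X Y f g a b′) where

    -- By `not-above` and its mirror image, `a` itself blocks the ray from `a′` to `b′`.
    aligned : ¬ X 0ℚ (f a) (f a′) → ¬ X 0ℚ (f b′) (f b) → ⊥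
    aligned a′<a b<b′ =
      not-above isX isY a′b ab a′b′ ab′ a′<a b<b′ λ a≤p →
      not-above isX Y⁻ (mirror a′b) (mirror ab) (mirror a′b′) (mirror ab′) a′<a b<b′ λ p≤a →
      clear a′b′ a a′<a (sep⇒< isX (ahead ab′)) (a≤p , p≤a)

  module _ {a a′ b b′ : V}
           (a′b : Sight X Y f g a′ b) (ab : Sight X Y f g a b)
           (a′b′ : Sight X Y f g a′ b′) (ab′ : Sight X Y f g a b′) where

    one-behind : Apart X Y f g b b′ → ¬ X 0ℚ (f a) (f a′) → ⊥
    one-behind ap a′<a = separated ap
      (λ x → aligned a′b ab a′b′ ab′ a′<a (sep⇒< isX x))
      (λ x → aligned a′b′ ab′ a′b ab a′<a (sep⇒< isX x))
      (split isX isY a′b ab a′b′ ab′ a′<a)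
      (split isX isY a′b′ ab′ a′b ab a′<a)

    -- If `b` and `b′` are separated along `X`, this is `split` seen backwards, with the two sides
    -- exchanged. If they are separated along `Y`, the offsets add up to put `a′` a full unit beyond
    -- a square that it sees.
    one-above : Apart X Y f g b b′ → ¬ Y (- 1ℚ) (g a) (g a′)
    one-above ap a<a′ = separated ap
      (λ x → split X⁻ isY (backwards ab′) (backwards ab) (backwards a′b′) (backwards a′b)
               (sep⇒< isX x) a<a′)
      (λ x → split X⁻ isY (backwards ab) (backwards ab′) (backwards a′b) (backwards a′b′)
               (sep⇒< isX x) a<a′)
      (λ y → near′ isX isY a′b (≤-trans isY y (≤-trans isY (≤-total isY (near isX isY ab′)) a<a′)))
      (λ y → near′ isX isY a′b′ (≤-trans isY y (≤-trans isY (≤-total isY (near isX isY ab)) a<a′)))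

  no-common-K₂₂ : ∀ {a a′ b b′} → Apart X Y f g a a′ → Apart X Y f g b b′ →
                  Sight X Y f g a b → Sight X Y f g a b′ →
                  Sight X Y f g a′ b → Sight X Y f g a′ b′ → ⊥
  no-common-K₂₂ apa apb ab ab′ a′b a′b′ = separated apa
    (λ x → one-behind ab a′b ab′ a′b′ apb (sep⇒< isX x))
    (λ x → one-behind a′b ab a′b′ ab′ apb (sep⇒< isX x))
    (one-above a′b ab a′b′ ab′ apb)
    (one-above ab a′b ab′ a′b′ apb)

-- Tripods: three squares seen from two perpendicular directions and by a third square

module _ {V : Set} {X Y : Comparison} (isX : IsLine X) (isY : IsLine Y) {f g : V → ℝ} {w : V} where

  Glance : V → Set₁
  Glance o = Sight X Y f g w o ⊎ Sight Y X g f w o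

  odd-left : ∀ {o m} → Sight Y X g f w o → Sight X Y f g w m → ¬ X 0ℚ (f m) (f o)
  odd-left so sm m≤o = near isY isX so (≤-trans isX (ahead sm) m≤o)

  odd-above : ∀ {o m} → Sight Y X g f w o → Sight X Y f g w m → ¬ Y 0ℚ (g o) (g m)
  odd-above so sm o≤m = near isX isY sm (≤-trans isY (ahead so) o≤m)

  -- If `w` sees all three along `X`, the line to `s` passes below the nearer `l`, which puts `w`
  -- below `l`, and the line to `t` puts `w` above it. A target seen along `Y` is left of and above
  -- every target seen along `X`; this leaves only the case that `l` and `t` are both seen along
  -- `Y`.
  middle : ∀ {s l t} → (Sight Y X g f w l → Sight Y X g f w t → ⊥) →
           Glance s → Glance l → Glance t →
           ¬ X 0ℚ (f s) (f l) → ¬ X 0ℚ (f t) (f l) →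
           ¬ Y 0ℚ (g l) (g s) → ¬ Y 0ℚ (g t) (g l) → ⊥
  middle _ (inj₁ s) (inj₁ l) (inj₁ t) l<s l<t s<l l<t′ =
    peek isX isY l t l<t (≤-total isY l<t′)
      (≤-total isY (peek isX (reverse-isLine isY) (mirror l) (mirror s) l<s (≤-total isY s<l)))
  middle _ (inj₂ s) (inj₁ l) (inj₁ t) l<s l<t s<l l<t′ = odd-left s l (≤-total isX l<s)
  middle _ _ (inj₂ l) (inj₁ t) l<s l<t s<l l<t′ = odd-above l t (≤-total isY l<t′)
  middle _ _ (inj₁ l) (inj₂ t) l<s l<t s<l l<t′ = odd-left t l (≤-total isX l<t)
  middle twice _ (inj₂ l) (inj₂ t) l<s l<t s<l l<t′ = twice l t

  -- If all are seen along `X`, the line to `k` passes above the nearer `i`, so `w` is above `i` and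
  -- hence too far above `j`. The other cases go as in `middle`.
  stair : ∀ {j i k} → (Sight Y X g f w i → Sight Y X g f w k → ⊥) →
          Glance j → Glance i → Glance k →
          ¬ X 0ℚ (f k) (f i) → Y (- 1ℚ) (g j) (g i) → ¬ Y 0ℚ (g k) (g i) → ⊥
  stair _ (inj₁ j) (inj₁ i) (inj₁ k) i<k j<i i<k′ =
    near′ isX isY j (≤-trans isY j<i (≤-total isY (peek isX isY i k i<k (≤-total isY i<k′))))
  stair _ (inj₂ j) (inj₁ i) (inj₁ k) i<k j<i i<k′ = odd-above j i (sep⇒≤ isY j<i)
  stair _ _ (inj₂ i) (inj₁ k) i<k j<i i<k′ = odd-above i k (≤-total isY i<k′)
  stair _ _ (inj₁ i) (inj₂ k) i<k j<i i<k′ = odd-left k i (≤-total isX i<k)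
  stair twice _ (inj₂ i) (inj₂ k) i<k j<i i<k′ = twice i k

module _ {V : Set} {X Y : Comparison} (isX : IsLine X) (isY : IsLine Y) {f g : V → ℝ} {p q w : V}
         (apart-pw : Apart X Y f g p w) where

  private
    X⁻ : IsLine (reverse X)
    X⁻ = reverse-isLine isX
    Y⁻ : IsLine (reverse Y)
    Y⁻ = reverse-isLine isY

  -- With `X` pointing right and `Y` pointing up, `p` looks up, `q` looks left, and `w` looks right
  -- or up.
  record Target (o : V) : Set₁ where
    constructor target
    field
      from-p : Sight Y X g f p o
      from-q : Sight (reverse X) Y f g q o
      from-w : Glance isX isY {f} {g} {w} o
  open Target

  module _ {i j k : V} (ti : Target i) (tj : Target j) (tk : Target k)
           (ij : Apart X Y f g i j) (ik : Apart X Y f g i k) (jk : Apart X Y f g j k) where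

    private
      twice : ∀ {a b} → Target a → Target b → Apart X Y f g a b →
              Sight Y X g f w a → Sight Y X g f w b → ⊥
      twice ta tb ab = no-common-K₂₂ isY isX (Apart-swap apart-pw) (Apart-swap ab)
        (from-p ta) (from-p tb)

    module _ (j<i : Y (- 1ℚ) (g j) (g i)) where

      private
        q≤i : Y 0ℚ (g q) (g i)
        q≤i = ≰⇒≥ isY λ i≤q → near′ X⁻ isY (from-q tj) (≤-trans isY j<i i≤q)
        j≤q : Y 0ℚ (g j) (g q)
        j≤q = ≰⇒≥ isY λ q≤j → near X⁻ isY (from-q ti) (≤-trans isY q≤j j<i)

      -- In height `q` lies between `j` and `i`, so `k` is on the same side of `q` as one of them.
      -- Visibility from `q` and closeness to `p` then force `k` to the left of both, at a height
      -- between theirs, against `middle`.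
      p-left-of-both : X 0ℚ (f p) (f i) → X 0ℚ (f p) (f j) → ¬ X 0ℚ (f j) (f i) → ⊥
      p-left-of-both p≤i p≤j i<j = lower (≤-total isY upper)
        where
        upper : ¬ Y 0ℚ (g q) (g k)
        upper q≤k = same-side X⁻ isY (from-q ti) (from-q tk) (Apart-reverseˡ ik) q≤i q≤k
          (λ k<i k<i′ → middle isX isY (twice tk ti (Apart-sym ik))
             (from-w tj) (from-w tk) (from-w ti)
             (λ j≤k → i<j (sep⇒≤ isX (≤-trans isX j≤k k<i))) (sep⇒< isX k<i)
             (λ k≤j → near X⁻ isY (from-q ti) (≤-trans isY q≤k (≤-trans isY k≤j j<i))) k<i′)
          (λ i<k _ → near isY isX (from-p tk) (≤-trans isX p≤i i<k))
        lower : ¬ Y 0ℚ (g k) (g q)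
        lower k≤q = same-side X⁻ Y⁻ (mirror (from-q tj)) (mirror (from-q tk))
          (Apart-reverseʳ (Apart-reverseˡ jk)) j≤q k≤q
          (λ k<j j<k′ → middle isX isY (twice tk ti (Apart-sym ik))
             (from-w tj) (from-w tk) (from-w ti)
             (sep⇒< isX k<j)
             (λ i≤k → near isY isX (from-p tj) (≤-trans isX (≤-trans isX p≤i i≤k) k<j))
             j<k′
             (λ i≤k → near′ X⁻ isY (from-q tj) (≤-trans isY (≤-trans isY j<i i≤k) k≤q)))
          (λ j<k _ → near isY isX (from-p tk) (≤-trans isX p≤j j<k))

      -- Closeness to `p` now puts `k` either to the right of and above `i`, against `stair`, or to
      -- the right of and below `j`, against `middle` with `j` as the leftmost square.
      p-right-of-both : X 0ℚ (f i) (f p) → X 0ℚ (f j) (f p) → ¬ X 0ℚ (f i) (f j) → ⊥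
      p-right-of-both i≤p j≤p j<i′ = lower (≤-total isY upper)
        where
        upper : ¬ Y 0ℚ (g q) (g k)
        upper q≤k = same-side X⁻ isY (from-q ti) (from-q tk) (Apart-reverseˡ ik) q≤i q≤k
          (λ k<i _ → near′ isY isX (from-p tk) (≤-trans isX k<i i≤p))
          (λ i<k i<k′ → stair isX isY (twice ti tk ik)
             (from-w tj) (from-w ti) (from-w tk) (sep⇒< isX i<k) j<i i<k′)
        lower : ¬ Y 0ℚ (g k) (g q)
        lower k≤q = same-side X⁻ Y⁻ (mirror (from-q tj)) (mirror (from-q tk))
          (Apart-reverseʳ (Apart-reverseˡ jk)) j≤q k≤q
          (λ k<j _ → near′ isY isX (from-p tk) (≤-trans isX k<j j≤p))
          (λ j<k k<j′ → middle isX isY (twice tj ti (Apart-sym ij))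
             (from-w tk) (from-w tj) (from-w ti)
             (sep⇒< isX j<k) j<i′ k<j′ (sep⇒< isY j<i))

  module _ {i j k : V} (ti : Target i) (tj : Target j) (tk : Target k)
           (ij : Apart X Y f g i j) (ik : Apart X Y f g i k) (jk : Apart X Y f g j k) where

    not-both-right : X 0ℚ (f p) (f i) → X 0ℚ (f p) (f j) → ⊥
    not-both-right p≤i p≤j = same-side isY isX (from-p ti) (from-p tj) (Apart-swap ij) p≤i p≤j
      (λ i<j → p-left-of-both tj ti tk (Apart-sym ij) jk ik i<j p≤j p≤i)
      (λ j<i → p-left-of-both ti tj tk ij ik jk j<i p≤i p≤j)

    not-both-left : X 0ℚ (f i) (f p) → X 0ℚ (f j) (f p) → ⊥
    not-both-left i≤p j≤p = same-side isY X⁻ (mirror (from-p ti)) (mirror (from-p tj))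
      (Apart-reverseʳ (Apart-swap ij)) i≤p j≤p
      (λ i<j → p-right-of-both tj ti tk (Apart-sym ij) jk ik i<j j≤p i≤p)
      (λ j<i → p-right-of-both ti tj tk ij ik jk j<i i≤p j≤p)

  -- By the pigeonhole principle two of the three targets lie on the same side of `p` along `X`.
  no-tripod : ∀ {i j k} → Target i → Target j → Target k →
              Apart X Y f g i j → Apart X Y f g i k → Apart X Y f g j k → ⊥
  no-tripod {i} {j} {k} ti tj tk ij ik jk = ¬¬p≤i λ p≤i → ¬¬p≤j λ p≤j →
    not-both-right ti tj tk ij ik jk p≤i p≤j
    where
    ki = Apart-sym ik
    kj = Apart-sym jk
    ¬¬p≤i : ¬ ¬ X 0ℚ (f p) (f i)
    ¬¬p≤i i<p = not-both-right tj tk ti jk (Apart-sym ij) ki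
      (≰⇒≥ isX λ j≤p → not-both-left ti tj tk ij ik jk (≤-total isX i<p) j≤p)
      (≰⇒≥ isX λ k≤p → not-both-left ti tk tj ik ij kj (≤-total isX i<p) k≤p)
    ¬¬p≤j : ¬ ¬ X 0ℚ (f p) (f j)
    ¬¬p≤j j<p = not-both-right ti tk tj ik ij kj
      (≰⇒≥ isX λ i≤p → not-both-left ti tj tk ij ik jk i≤p (≤-total isX j<p))
      (≰⇒≥ isX λ k≤p → not-both-left tj tk ti jk (Apart-sym ij) ki (≤-total isX j<p) k≤p)

-- The real line

-- The unit is ½ + ½ because x≰x-1 climbs in steps of ½.
fromℕ : ℕ → ℚ
fromℕ zero    = 0ℚ
fromℕ (suc n) = fromℕ n + (½ + ½)

toℚᵘ-fromℕ : ∀ n → toℚᵘ (fromℕ n) ≃ᵘ mkℚᵘ (+ n) 0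
toℚᵘ-fromℕ zero    = *≡* refl
toℚᵘ-fromℕ (suc n) = ℚᵘ.≃-trans (ℚ.toℚᵘ-homo-+ (fromℕ n) (½ + ½))
  (ℚᵘ.≃-trans (ℚᵘ.+-congˡ (toℚᵘ (½ + ½)) (toℚᵘ-fromℕ n)) (*≡* (eq (+ n))))
  where
  open ℤ-Solver.+-*-Solver
  eq : ∀ a → (a ℤ.* + 1 ℤ.+ + 1) ℤ.* + 1 ≡ (+ 1 ℤ.+ a) ℤ.* + 1
  eq = solve 1 (λ a → (a :* con (+ 1) :+ con (+ 1)) :* con (+ 1)
                      := (con (+ 1) :+ a) :* con (+ 1)) refl

archimedean : ∀ p → ∃[ n ] p <ℚ fromℕ n
-- The denominator is at least 1, so one more than the absolute value of the numerator suffices.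
archimedean p@(mkℚ a b _) = suc ℤ.∣ a ∣ ,
  ℚ.toℚᵘ-cancel-< (ℚᵘ.<-respʳ-≃ (ℚᵘ.≃-sym (toℚᵘ-fromℕ (suc ℤ.∣ a ∣))) (*<* (bound a)))
  where
  bound : ∀ a → a ℤ.* + 1 ℤ.< + suc ℤ.∣ a ∣ ℤ.* + suc b
  bound (+ n)    = ℤ.≤-<-trans (ℤ.≤-reflexive (ℤ.*-identityʳ (+ n))) (ℤ.+<+ (ℕ.m≤m*n (suc n) (suc b)))
  bound -[1+ n ] = ℤ.≤-<-trans (ℤ.≤-reflexive (ℤ.*-identityʳ -[1+ n ])) ℤ.-<+

open +-*-Solver using (solve; _:+_; _:-_; :-_; _:=_)

module _ (x : ℝ) where

  Lower-down : ∀ {p q} → p <ℚ q → Lower x q → Lower x p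
  Lower-down p<q l = Equivalence.from (lowerRounded x _) (_ , p<q , l)

  Upper-up : ∀ {p q} → p <ℚ q → Upper x p → Upper x q
  Upper-up p<q u = Equivalence.from (upperRounded x _) (_ , p<q , u)

  Lower<Upper : ∀ {p q} → Lower x p → Upper x q → p <ℚ q
  Lower<Upper {p} {q} l u with ℚ.<-cmp p q
  ... | tri< p<q _ _ = p<q
  ... | tri≈ _ refl _ = ⊥-elim (disjoint x p (l , u))
  ... | tri> _ _ q<p = ⊥-elim (disjoint x p (l , Upper-up q<p u))

p<p+½ : ∀ p → p <ℚ p + ½
p<p+½ p = subst (_<ℚ p + ½) (ℚ.+-identityʳ p) (ℚ.+-monoʳ-< p (ℚ.positive⁻¹ ½))

-- The form `p - - 1ℚ` is the one to which `Upper (x ⊕ (- 1ℚ)) p` unfolds.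
½+½ : ∀ p → (p + ½) + ½ ≡ p - - 1ℚ
½+½ p = trans (ℚ.+-assoc p ½ ½) (cong (λ e → p + e) 1≡)
  where
  1≡ : ½ + ½ ≡ - - 1ℚ
  1≡ = refl

p+½<p+1 : ∀ p → p + ½ <ℚ p - - 1ℚ
p+½<p+1 p = subst (p + ½ <ℚ_) (½+½ p) (p<p+½ (p + ½))

-- By locatedness, x ≤ x - 1 would make Lower x closed under adding ½, hence unbounded.
x≰x-1 : ∀ x → ¬ (x ≤ᴿ x ⊕ (- 1ℚ))
x≰x-1 x h with lowerInhabited x | upperInhabited x
... | l , Ll | u , Uu with archimedean (u - l)
... | n , u-l<n = disjoint x u (Lower-down x u<l+n (climb n) , Uu)
  where
  step : ∀ {q} → Lower x q → Lower x (q + ½)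
  step {q} Lq with located x (q + ½) (q - - 1ℚ) (p+½<p+1 q)
  ... | inj₁ L = L
  ... | inj₂ U = ⊥-elim (h (q , U , Lq))
  climb : ∀ n → Lower x (l + fromℕ n)
  climb zero    = subst (Lower x) (sym (ℚ.+-identityʳ l)) Ll
  climb (suc n) = subst (Lower x)
    (trans (ℚ.+-assoc (l + fromℕ n) ½ ½) (ℚ.+-assoc l (fromℕ n) (½ + ½)))
    (step (step (climb n)))
  u<l+n : u <ℚ l + fromℕ n
  u<l+n = subst (_<ℚ l + fromℕ n) (solve 2 (λ l u → l :+ (u :- l) := u) refl l u)
    (ℚ.+-monoʳ-< l u-l<n)

p-0 : ∀ p → p - 0ℚ ≡ p
p-0 p = trans (cong (λ e → p + e) -0≡0) (ℚ.+-identityʳ p)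
  where
  -0≡0 : - 0ℚ ≡ 0ℚ
  -0≡0 = refl

p+c-c : ∀ p c → (p + c) - c ≡ p
p+c-c = solve 2 (λ p c → (p :+ c) :- c := p) refl

p-c+c : ∀ p c → (p - c) + c ≡ p
p-c+c = solve 2 (λ p c → (p :- c) :+ c := p) refl

p--c-c : ∀ p c → (p - - c) - c ≡ p
p--c-c = solve 2 (λ p c → (p :- (:- c)) :- c := p) refl

p-c--c : ∀ p c → (p - c) - - c ≡ p
p-c--c = solve 2 (λ p c → (p :- c) :- (:- c) := p) refl

p-[c+d]+d : ∀ p c d → (p - (c + d)) + d ≡ p - c
p-[c+d]+d = solve 3 (λ p c d → (p :- (c :+ d)) :+ d := p :- c) refl

forward : Comparison
forward c x y = x ≤ᴿ y ⊕ c

forward-isLine : IsLine forward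
forward-isLine .≤-refl {x} (q , U , L) = disjoint x q (L , subst (Upper x) (p-0 q) U)
-- Rounding `s - (c + d)` down to `r` opens a gap from `r + d` to `s - c`. Locating `y` with respect
-- to this gap contradicts one of the hypotheses either way.
forward-isLine .≤-trans {c} {d} {x} {y} {z} x≤y y≤z (s , U , L) =
  via (Equivalence.to (upperRounded z (s - (c + d))) U)
  where
  compare : ∀ {r} → Upper z r → Lower y (r + d) ⊎ Upper y (s - c) → ⊥
  compare {r} Ur (inj₁ Ly) = y≤z (r + d , subst (Upper z) (sym (p+c-c r d)) Ur , Ly)
  compare     Ur (inj₂ Uy) = x≤y (s , Uy , L)
  via : (∃[ r ] (r <ℚ s - (c + d) × Upper z r)) → ⊥
  via (r , r<s-c-d , Ur) = compare Ur (located y (r + d) (s - c)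
    (subst (r + d <ℚ_) (p-[c+d]+d s c d) (ℚ.+-monoˡ-< d r<s-c-d)))
forward-isLine .≤-total {c} {x} {y} x≰y (q , U , L) = x≰y λ where
  (r , Ur , Lr) → ℚ.<-asym (Lower<Upper y L Ur)
    (subst (r - c <ℚ_) (p--c-c q c) (ℚ.+-monoˡ-< (- c) (Lower<Upper x Lr U)))
forward-isLine .≤-irrefl {x} = x≰x-1 x

<-trans : ∀ {x y z} → x <ᴿ y → y <ᴿ z → x <ᴿ z
<-trans {y = y} {z} (q , Ux , Ly) (r , Uy , Lz) = q , Ux , Lower-down z (Lower<Upper y Ly Uy) Lz

<-≤-trans : ∀ {x y z} → x <ᴿ y → y ≤ᴿ z → x <ᴿ z
<-≤-trans {x} {y} {z} (q , Ux , Ly) y≤z with Equivalence.to (lowerRounded y q) Ly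
... | r , q<r , Lr with located z q r q<r
... | inj₁ Lz = q , Ux , Lz
... | inj₂ Uz = ⊥-elim (y≤z (r , Uz , Lr))

≤-<-trans : ∀ {x y z} → x ≤ᴿ y → y <ᴿ z → x <ᴿ z
≤-<-trans {x} {y} {z} x≤y (q , Uy , Lz) with Equivalence.to (upperRounded y q) Uy
... | r , r<q , Ur with located x r q r<q
... | inj₁ Lx = ⊥-elim (x≤y (r , Ur , Lx))
... | inj₂ Ux = q , Ux , Lz

<-⊕⇒⊕-< : ∀ {x y} c → x <ᴿ y ⊕ c → x ⊕ (- c) <ᴿ y
<-⊕⇒⊕-< {x} c (q , U , L) = q - c , subst (Upper x) (sym (p-c--c q c)) U , L

⊕-<⇒<-⊕ : ∀ {x y} c → x ⊕ (- c) <ᴿ y → x <ᴿ y ⊕ c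
⊕-<⇒<-⊕ {y = y} c (q , U , L) = q - - c , U , subst (Lower y) (sym (p--c-c q c)) L

<⇒⊕0< : ∀ {x y} → x <ᴿ y → x ⊕ 0ℚ <ᴿ y
<⇒⊕0< {x} (q , U , L) = q , subst (Upper x) (sym (p-0 q)) U , L

x≮x : ∀ {x} → ¬ x <ᴿ x
x≮x {x} (q , U , L) = disjoint x q (L , U)

¬¬x<x+1 : ∀ x → ¬ ¬ (x <ᴿ x ⊕ 1ℚ)
¬¬x<x+1 x h = ≤-irrefl forward-isLine {x} λ lt → h (⊕-<⇒<-⊕ {x} {x} 1ℚ lt)

ι : ℚ → ℝ
ι q .Lower r = r <ℚ q
ι q .Upper r = q <ℚ r
ι q .lowerInhabited = q - ½ , subst (q - ½ <ℚ_) (p-c+c q ½) (p<p+½ (q - ½))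
ι q .upperInhabited = q + ½ , p<p+½ q
ι q .lowerRounded r = mk⇔ (λ r<q → let s , r<s , s<q = ℚ.<-dense r<q in s , r<s , s<q)
                          (λ (_ , r<s , s<q) → ℚ.<-trans r<s s<q)
ι q .upperRounded r = mk⇔ (λ q<r → let s , q<s , s<r = ℚ.<-dense q<r in s , s<r , q<s)
                          (λ (_ , s<r , q<s) → ℚ.<-trans q<s s<r)
ι q .disjoint r (r<q , q<r) = ℚ.<-asym r<q q<r
ι q .located r s r<s with ℚ.<-cmp r q
... | tri< r<q _ _ = inj₁ r<q
... | tri≈ _ refl _ = inj₂ r<s
... | tri> _ _ q<r = inj₂ (ℚ.<-trans q<r r<s)

Upper⇒<ι : ∀ x {q} → Upper x q → x <ᴿ ι q
Upper⇒<ι x {q} U = let r , r<q , Ur = Equivalence.to (upperRounded x q) U in r , Ur , r<q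

Lower⇒ι< : ∀ x {q} → Lower x q → ι q <ᴿ x
Lower⇒ι< x {q} L = let r , q<r , Lr = Equivalence.to (lowerRounded x q) L in r , q<r , Lr

between : ∀ {l h} → l <ᴿ h → Σ[ x ∈ ℝ ] (l <ᴿ x × x <ᴿ h)
between {l} {h} (q , U , L) = ι q , Upper⇒<ι l U , Lower⇒ι< h L

-- Each lower end has a rational above it and below both upper ends; the larger of these two
-- rationals serves.
common : ∀ {l l′ h h′} → l <ᴿ h → l <ᴿ h′ → l′ <ᴿ h → l′ <ᴿ h′ →
         Σ[ x ∈ ℝ ] ((l <ᴿ x × x <ᴿ h) × (l′ <ᴿ x × x <ᴿ h′))
common {l} {l′} {h} {h′} a b c d with below {l} a b | below {l′} c d
  where
  below : ∀ {l} → l <ᴿ h → l <ᴿ h′ → ∃[ q ] (Upper l q × Lower h q × Lower h′ q)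
  below (q , U , L) (q′ , U′ , L′) with ℚ.<-cmp q q′
  ... | tri< q<q′ _ _ = q , U , L , Lower-down h′ q<q′ L′
  ... | tri≈ _ refl _ = q , U , L , L′
  ... | tri> _ _ q′<q = q′ , U′ , Lower-down h q′<q L , L′
... | q , U , L , L′ | q′ , U′ , M , M′ with ℚ.<-cmp q q′
... | tri< q<q′ _ _ =
  ι q′ , (Upper⇒<ι l (Upper-up l q<q′ U) , Lower⇒ι< h M) , Upper⇒<ι l′ U′ , Lower⇒ι< h′ M′
... | tri≈ _ refl _ =
  ι q , (Upper⇒<ι l U , Lower⇒ι< h L) , Upper⇒<ι l′ U′ , Lower⇒ι< h′ L′
... | tri> _ _ q′<q =
  ι q , (Upper⇒<ι l U , Lower⇒ι< h L) , Upper⇒<ι l′ (Upper-up l′ q′<q U′) , Lower⇒ι< h′ L′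

-- From bands of visibility to sights

-- `<` carries a rational witness and `≤` is its negation, so a strict inequality is recovered only
-- up to double negation.
≰⇒< : ∀ {x y} → ¬ forward (- 1ℚ) x y → ¬ ¬ (y <ᴿ x ⊕ 1ℚ)
≰⇒< {x} {y} x≰y h = x≰y λ lt → h (⊕-<⇒<-⊕ {y} {x} 1ℚ lt)

<⇒≰ : ∀ {x y} → x <ᴿ y ⊕ 1ℚ → ¬ forward (- 1ℚ) y x
<⇒≰ {x} {y} x<y+1 y≤x-1 = y≤x-1 (<-⊕⇒⊕-< {x} {y} 1ℚ x<y+1)

InUnit : ℝ → ℝ → Set
InUnit l x = l <ᴿ x × x <ᴿ l ⊕ 1ℚ

overlapping : ∀ {l l′} → ¬ forward (- 1ℚ) l l′ → ¬ forward (- 1ℚ) l′ l →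
              ¬ ¬ (Σ[ x ∈ ℝ ] (InUnit l x × InUnit l′ x))
overlapping {l} {l′} p q h =
  ¬¬x<x+1 l λ a → ¬¬x<x+1 l′ λ d → ≰⇒< {l} {l′} p λ c → ≰⇒< {l′} {l} q λ b →
  h (common {l} {l′} {l ⊕ 1ℚ} {l′ ⊕ 1ℚ} a b c d)

module _ {V : Set} (S : V → UnitSquare) (dis : DisjointInteriors S) where

  private
    f g : V → ℝ
    f = left ∘ S
    g = bottom ∘ S

  collinear : ∀ {v w} → v ≢ w → ∀ y → InUnit (g v) y → InUnit (g w) y →
              ¬ forward (- 1ℚ) (f v) (f w) → ¬ forward (- 1ℚ) (f w) (f v) → ⊥
  collinear {v} {w} v≢w y yv yw p q = overlapping {f v} {f w} p q λ (x , xv , xw) →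
    dis v w v≢w ((x , y) , (xv , yv) , (xw , yw))

  disjoint⇒apart : ∀ {v w} → v ≢ w → Apart forward forward f g v w
  disjoint⇒apart {v} {w} v≢w .separated p q r s = overlapping {g v} {g w} r s λ (y , yv , yw) →
    collinear v≢w y yv yw p q

  band⇒sight : ∀ {v w} → HorizontalBand S v w → forward (- 1ℚ) (f v) (f w) →
               Sight forward forward f g v w
  band⇒sight {v} {w} (a , b , (q , Ua , Lb) , band) v≤w-1 = record
    { ahead  = v≤w-1
    ; ray    = ρ
    ; meetsˡ = meets {v} (proj₁ at-y)
    ; meetsʳ = meets {w} (proj₁ (proj₂ at-y))
    ; clear  = unblocked
    }
    where
    y ρ : ℝ
    y = ι q
    ρ = y ⊕ (- ½)

    a<y : a <ᴿ y
    a<y = Upper⇒<ι a Ua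

    y<b : y <ᴿ b
    y<b = Lower⇒ι< b Lb

    at-y = band y a<y y<b

    ρ≤y-½ : forward (- ½) ρ y
    ρ≤y-½ = x≮x {ρ}

    y≤ρ+½ : forward ½ y ρ
    y≤ρ+½ (r , U , L) = disjoint y r (L , subst (Upper y) (p-c--c r ½) U)

    meets : ∀ {u} → LineMeetsInterior y (S u) → Meets forward (g u) ρ
    meets {u} (_ , _ , (gu<y , y<gu+1)) =
        (λ gu≤ρ-½ → <⇒≰ {y} {g u} y<gu+1
          (≤-trans forward-isLine { - ½} { - ½} {g u} {ρ} {y} gu≤ρ-½ ρ≤y-½))
      , (λ ρ≤gu-½ → ≤-trans forward-isLine {½} { - ½} {y} {ρ} {g u} y≤ρ+½ ρ≤gu-½
          (<⇒⊕0< {g u} {y} gu<y))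

    -- The bounds on `g u` are not strict, so the line may merely touch the boundary of `u`; a
    -- nearby line of the open band then meets its interior.
    unblocked : ∀ u → ¬ forward 0ℚ (f u) (f v) → ¬ forward 0ℚ (f w) (f u) →
                ¬ (forward ½ (g u) ρ × forward ½ ρ (g u))
    unblocked u v<u u<w (gu≤ρ+½ , ρ≤gu+½) =
      ¬¬x<x+1 (g u) λ gu<gu+1 → blocked (common {a} {g u} {b} {g u ⊕ 1ℚ} a<b a<gu+1 gu<b gu<gu+1)
      where
      gu≤y : forward 0ℚ (g u) y
      gu≤y = ≤-trans forward-isLine {½} { - ½} {g u} {ρ} {y} gu≤ρ+½ ρ≤y-½
      gu<b : g u <ᴿ b
      gu<b = ≤-<-trans {g u} {y ⊕ 0ℚ} {b} gu≤y (<⇒⊕0< {y} {b} y<b)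
      a<gu+1 : a <ᴿ g u ⊕ 1ℚ
      a<gu+1 = <-≤-trans {a} {y} {g u ⊕ 1ℚ} a<y
        (≤-trans forward-isLine {½} {½} {y} {ρ} {g u} y≤ρ+½ ρ≤gu+½)
      a<b : a <ᴿ b
      a<b = <-trans {a} {y} {b} a<y y<b
      v≢u : v ≢ u
      v≢u refl = v<u (≤-refl forward-isLine {f v})
      u≢w : u ≢ w
      u≢w refl = u<w (≤-refl forward-isLine {f w})
      blocked : Σ[ z ∈ ℝ ] ((a <ᴿ z × z <ᴿ b) × InUnit (g u) z) → ⊥
      blocked (z , (a<z , z<b) , uz) with band z a<z z<b
      ... | (_ , _ , vz) , (_ , _ , wz) , free =
        -- All three squares meet the line at height `z`, so `u` is a unit away from `v` and from
        -- `w` along it, and its interior points there lie between them.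
        collinear v≢u z vz uz
          (λ v≤u-1 → collinear u≢w z uz wz
            (λ u≤w-1 → ¬¬x<x+1 (f u) λ fu<fu+1 →
              interior v≤u-1 u≤w-1 (between {f u} {f u ⊕ 1ℚ} fu<fu+1))
            (λ w≤u-1 → u<w (sep⇒≤ forward-isLine {f w} {f u} w≤u-1)))
          (λ u≤v-1 → v<u (sep⇒≤ forward-isLine {f u} {f v} u≤v-1))
        where
        interior : forward (- 1ℚ) (f v) (f u) → forward (- 1ℚ) (f u) (f w) →
                   Σ[ x ∈ ℝ ] InUnit (f u) x → ⊥
        interior v≤u-1 u≤w-1 (x , fu<x , x<fu+1) = free u (≢-sym v≢u) u≢w x
          (inj₁ ( (λ x<fv+1 → <⇒≰ {f u} {f v} (<-trans {f u} {x} {f v ⊕ 1ℚ} fu<x x<fv+1) v≤u-1)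
                , (λ fw<x → <⇒≰ {f w} {f u} (<-trans {f w} {x} {f u ⊕ 1ℚ} fw<x x<fu+1) u≤w-1)))
          ((fu<x , x<fu+1) , uz)

  band-sym : ∀ {v w} → HorizontalBand S v w → HorizontalBand S w v
  band-sym (a , b , a<b , band) = a , b , a<b , λ y a<y y<b →
    let v∋y , w∋y , free = band y a<y y<b in
    w∋y , v∋y , λ u u≢w u≢v x btw → free u u≢v u≢w x (Sum.swap btw)

  band⇒sights : ∀ {v w} → v ≢ w → HorizontalBand S v w →
                (Sight forward forward f g v w → ⊥) → (Sight forward forward f g w v → ⊥) → ⊥
  band⇒sights {v} {w} v≢w bd@(a , b , (q , Ua , Lb) , band) vw wv
    with band (ι q) (Upper⇒<ι a Ua) (Lower⇒ι< b Lb)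
  ... | (_ , _ , vy) , (_ , _ , wy) , _ = collinear v≢w (ι q) vy wy
    (λ v≤w-1 → vw (band⇒sight bd v≤w-1)) (λ w≤v-1 → wv (band⇒sight (band-sym bd) w≤v-1))

DisjointInteriors-transpose : ∀ {V : Set} {S : V → UnitSquare} →
                              DisjointInteriors S → DisjointInteriors (transpose ∘ S)
DisjointInteriors-transpose dis v w v≢w ((x , y) , (xv , yv) , (xw , yw)) =
  dis v w v≢w ((y , x) , (yv , xv) , (yw , xw))

-- Tables of directions

-- horizontal true is rightwards, vertical true is upwards.
data Direction : Set where
  horizontal vertical : Bool → Direction

opposite : Direction → Direction
opposite (horizontal s) = horizontal (not s)
opposite (vertical s)   = vertical (not s)

infix 7 _==_ _⊥ᵇ_

_==_ : Direction → Direction → Bool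
horizontal true  == horizontal true  = true
horizontal false == horizontal false = true
vertical true    == vertical true    = true
vertical false   == vertical false   = true
_                == _                = false

_⊥ᵇ_ : Direction → Direction → Bool
horizontal _ ⊥ᵇ vertical _   = true
vertical _   ⊥ᵇ horizontal _ = true
_            ⊥ᵇ _            = false

anyFin : ∀ {n} → (Fin n → Bool) → Bool
anyFin p = any p (allFin _)

anyPair : ∀ {A : Set} {n} → (A → A → Bool) → Vec A n → Bool
anyPair p []       = false
anyPair p (x ∷ xs) = anyFin (λ i → p x (lookup xs i)) ∨ anyPair p xs

anyTriple : ∀ {A : Set} {n} → (A → A → A → Bool) → Vec A n → Bool
anyTriple p []       = false
anyTriple p (x ∷ xs) = anyPair (p x) xs ∨ anyTriple p xs

-- s, t, u and v are the directions of the consecutive steps of a closed walk.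
adjacent alternate cyclic : (s t u v : Direction) → Bool
adjacent  s t u v = s == t ∧ not (u == opposite s) ∧ not (v == opposite s)
alternate s t u v = s == u ∧ not (t == opposite s) ∧ not (v == opposite s)
cyclic s t u v =
  adjacent s t u v ∨ adjacent t u v s ∨ adjacent u v s t ∨ adjacent v s t u ∨
  alternate s t u v ∨ alternate t u v s

-- The columns of the 2 × 2 table are (a , b) and (c , d), so the closed walk through its four
-- edges takes those of b and c backwards.
badSquare : (a b c d : Direction) → Bool
badSquare a b c d = (a == b ∧ a == c ∧ a == d) ∨ cyclic a (opposite b) d (opposite c)

Column : ℕ → Set
Column m = Vec Direction m

badPair : Direction × Direction → Direction × Direction → Bool
badPair (a , c) (b , d) = badSquare a b c d

clash : ∀ {m} → Column m → Column m → Bool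
clash c d = anyPair badPair (Vec.zip c d)

third : Direction → Direction → Direction → Bool
third d e s = s == d ∨ s == opposite e

-- Three columns, whose rows p, q and r belong to the three squares seeing the other three.
tripod : ∀ {m} → (x y z : Fin m → Direction) → Bool
tripod x y z = anyFin λ p → (x p == y p ∧ x p == z p) ∧ anyFin λ q →
  (x p ⊥ᵇ x q ∧ x q == y q ∧ x q == z q) ∧ anyFin λ r →
  not ⌊ p Fin.≟ r ⌋ ∧ third (x p) (x q) (x r) ∧ third (x p) (x q) (y r) ∧ third (x p) (x q) (z r)

-- The table with the two sides of the bipartite graph exchanged.
row : ∀ {m k} → Vec (Column m) k → Fin m → Fin k → Direction
row cs i k = opposite (lookup (lookup cs k) i)

rowTripod : ∀ {m k} → Vec (Column m) k → Bool
rowTripod cs = anyTriple (λ i j l → tripod (row cs i) (row cs j) (row cs l)) (Vec.allFin _)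

columnTripod : ∀ {m k} → Column m → Vec (Column m) k → Bool
columnTripod c cs = anyPair (λ d e → tripod (lookup c) (lookup d) (lookup e)) cs

-- cands are the columns which do not clash with any of the columns cs chosen so far.
refuted : ∀ {m k} → ℕ → Vec (Column m) k → List (Column m) → Bool
refuted zero    cs _     = rowTripod cs
refuted (suc n) cs cands =
  all (λ c → columnTripod c cs ∨ refuted n (c ∷ cs) (filterᵇ (λ d → not (clash c d)) cands)) cands

directions : List Direction
directions = horizontal true ∷ horizontal false ∷ vertical true ∷ vertical false ∷ []

columns : ∀ m → List (Column m)
columns zero    = [] ∷ []
columns (suc m) = cartesianProductWith _∷_ directions (columns m)

-- Reflecting the Boolean tests

==⇒≡ : ∀ {d e} → T (d == e) → d ≡ e
==⇒≡ {horizontal true}  {horizontal true}  _ = refl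
==⇒≡ {horizontal false} {horizontal false} _ = refl
==⇒≡ {vertical true}    {vertical true}    _ = refl
==⇒≡ {vertical false}   {vertical false}   _ = refl
==⇒≡ {horizontal true}  {horizontal false} ()
==⇒≡ {horizontal false} {horizontal true}  ()
==⇒≡ {vertical true}    {vertical false}   ()
==⇒≡ {vertical false}   {vertical true}    ()
==⇒≡ {horizontal true}  {vertical _}       ()
==⇒≡ {horizontal false} {vertical _}       ()
==⇒≡ {vertical true}    {horizontal _}     ()
==⇒≡ {vertical false}   {horizontal _}     ()

∧⁻ : ∀ {x y} → T (x ∧ y) → T x × T y
∧⁻ = Equivalence.to T-∧

∨⁻ : ∀ {x y} → T (x ∨ y) → T x ⊎ T y
∨⁻ = Equivalence.to T-∨

anyFin⁻ : ∀ {n} {p : Fin n → Bool} → T (anyFin p) → ∃[ i ] T (p i)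
anyFin⁻ {p = p} t = satisfied (Any.any⁻ p (allFin _) t)

anyPair⁻ : ∀ {A : Set} {n} {p : A → A → Bool} (xs : Vec A n) → T (anyPair p xs) →
           ∃[ i ] ∃[ j ] (i ≢ j × T (p (lookup xs i) (lookup xs j)))
anyPair⁻ (x ∷ xs) t with ∨⁻ t
... | inj₁ u = let j , v = anyFin⁻ u in zero , suc j , (λ ()) , v
... | inj₂ u = let i , j , i≢j , v = anyPair⁻ xs u in suc i , suc j , i≢j ∘ Fin.suc-injective , v

anyTriple⁻ : ∀ {A : Set} {n} {p : A → A → A → Bool} (xs : Vec A n) → T (anyTriple p xs) →
             ∃[ i ] ∃[ j ] ∃[ k ]
               (i ≢ j × i ≢ k × j ≢ k × T (p (lookup xs i) (lookup xs j) (lookup xs k)))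
anyTriple⁻ (x ∷ xs) t with ∨⁻ t
... | inj₁ u = let j , k , j≢k , v = anyPair⁻ xs u in
  zero , suc j , suc k , (λ ()) , (λ ()) , j≢k ∘ Fin.suc-injective , v
... | inj₂ u = let i , j , k , i≢j , i≢k , j≢k , v = anyTriple⁻ xs u in
  suc i , suc j , suc k ,
  i≢j ∘ Fin.suc-injective , i≢k ∘ Fin.suc-injective , j≢k ∘ Fin.suc-injective , v

columns-complete : ∀ {m} (c : Column m) → c ∈ columns m
columns-complete []      = here refl
columns-complete (d ∷ c) = ∈-cartesianProductWith⁺ _∷_ (complete d) (columns-complete c)
  where
  complete : ∀ d → d ∈ directions
  complete (horizontal true)  = here refl
  complete (horizontal false) = there (here refl)
  complete (vertical true)    = there (there (here refl))
  complete (vertical false)   = there (there (there (here refl)))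

-- Sights in the four directions

orient : Bool → Comparison
orient true  = forward
orient false = reverse forward

orient-isLine : ∀ s → IsLine (orient s)
orient-isLine true  = forward-isLine
orient-isLine false = reverse-isLine forward-isLine

module _ {V : Set} {f g : V → ℝ} where

  turn : ∀ {X} t {v w} → Sight X forward f g v w → Sight X (orient t) f g v w
  turn true  s = s
  turn false s = mirror s

  away : ∀ s {Y v w} → Sight (orient s) Y f g v w → Sight (orient (not s)) Y f g w v
  away true  = backwards
  away false = backwards

  flipped : ∀ s {Y v w} → Sight (orient (not s)) Y f g v w → Sight (reverse (orient s)) Y f g v w
  flipped true  p = p
  flipped false p = p

  Apart-orient : ∀ s t {v w} → Apart forward forward f g v w → Apart (orient s) (orient t) f g v w
  Apart-orient true  true  a = a
  Apart-orient true  false a = Apart-reverseʳ a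
  Apart-orient false true  a = Apart-reverseˡ a
  Apart-orient false false a = Apart-reverseˡ (Apart-reverseʳ a)

module _ {V : Set} {f g : V → ℝ} (s t : Bool) {p q w : V} where

  record Seen (o : V) : Set₁ where
    constructor seen
    field
      by-p : Sight (orient t) forward g f p o
      by-q : Sight (orient s) forward f g q o
      by-w : Sight (orient (not s)) forward f g w o ⊎ Sight (orient t) forward g f w o
  open Seen

  no-three-seen : Apart forward forward f g p w → ∀ {i j k} → Seen i → Seen j → Seen k →
                  Apart forward forward f g i j → Apart forward forward f g i k →
                  Apart forward forward f g j k → ⊥
  no-three-seen pw si sj sk ij ik jk =
    -- In `Target` the square `q` looks against the first line, which is therefore
    -- `reverse (orient s)`; reversing it again gives `orient s` by computation.
    no-tripod (reverse-isLine (orient-isLine s)) (orient-isLine t) (apart′ pw)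
      (aim si) (aim sj) (aim sk) (apart′ ij) (apart′ ik) (apart′ jk)
    where
    apart′ : ∀ {v w} → Apart forward forward f g v w → Apart (reverse (orient s)) (orient t) f g v w
    apart′ a = Apart-reverseˡ (Apart-orient s t a)
    aim : ∀ {o} → Seen o → Target (reverse-isLine (orient-isLine s)) (orient-isLine t) (apart′ pw) o
    aim so = target (mirror (turn s (by-p so))) (turn t (by-q so))
      (Sum.map (λ w → flipped s (turn t w)) (λ w → mirror (turn s w)) (by-w so))

module Scene {V : Set} (x y : V → ℝ)
             (apart : ∀ {v w} → v ≢ w → Apart forward forward x y v w) where

  -- The transverse comparison is always `forward`; `turn` reverses it where a lemma needs that.
  Sees : Direction → V → V → Set₁
  Sees (horizontal s) = Sight (orient s) forward x y
  Sees (vertical s)   = Sight (orient s) forward y x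

  line : Direction → Comparison
  line (horizontal s) = orient s
  line (vertical s)   = orient s

  line-isLine : ∀ d → IsLine (line d)
  line-isLine (horizontal s) = orient-isLine s
  line-isLine (vertical s)   = orient-isLine s

  along : Direction → V → ℝ
  along (horizontal _) = x
  along (vertical _)   = y

  sees-back : ∀ d {v w} → Sees d v w → Sees (opposite d) w v
  sees-back (horizontal s) = away s
  sees-back (vertical s)   = away s

  sees-ahead : ∀ d {v w} → Sees d v w → line d (- 1ℚ) (along d v) (along d w)
  sees-ahead (horizontal s) = ahead
  sees-ahead (vertical s)   = ahead

  no-retreat : ∀ d e {v w} → T (not (e == opposite d)) → Sees e v w →
               ¬ line d (- 1ℚ) (along d w) (along d v)
  no-retreat (horizontal true)  (horizontal true)  _ p = no-return (orient-isLine true) p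
  no-retreat (horizontal false) (horizontal false) _ p = no-return (orient-isLine false) p
  no-retreat (vertical true)    (vertical true)    _ p = no-return (orient-isLine true) p
  no-retreat (vertical false)   (vertical false)   _ p = no-return (orient-isLine false) p
  no-retreat (horizontal s) (vertical t)   _ p = near′ (orient-isLine t) (orient-isLine s) (turn s p)
  no-retreat (vertical s)   (horizontal t) _ p = near′ (orient-isLine t) (orient-isLine s) (turn s p)
  no-retreat (horizontal true)  (horizontal false) ()
  no-retreat (horizontal false) (horizontal true)  ()
  no-retreat (vertical true)    (vertical false)   ()
  no-retreat (vertical false)   (vertical true)    ()

  module _ {s t u v : Direction} {a b c d : V}
           (ab : Sees s a b) (bc : Sees t b c) (cd : Sees u c d) (da : Sees v d a) where

    no-adjacent : ¬ T (adjacent s t u v)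
    no-adjacent bad with ∧⁻ {s == t} bad
    ... | s==t , bad′ with ==⇒≡ {s} {t} s==t | ∧⁻ {not (u == opposite s)} bad′
    ... | refl | u-ok , v-ok = no-cycle-adjacent (line-isLine s)
      (sees-ahead s ab) (sees-ahead s bc) (no-retreat s u u-ok cd) (no-retreat s v v-ok da)

    no-alternate : ¬ T (alternate s t u v)
    no-alternate bad with ∧⁻ {s == u} bad
    ... | s==u , bad′ with ==⇒≡ {s} {u} s==u | ∧⁻ {not (t == opposite s)} bad′
    ... | refl | t-ok , v-ok = no-cycle-alternate (line-isLine s)
      (sees-ahead s ab) (no-retreat s t t-ok bc) (sees-ahead s cd) (no-retreat s v v-ok da)

  no-cyclic : ∀ {s t u v a b c d} → Sees s a b → Sees t b c → Sees u c d → Sees v d a →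
              ¬ T (cyclic s t u v)
  no-cyclic {s} {t} {u} {v} ab bc cd da bad with ∨⁻ {adjacent s t u v} bad
  ... | inj₁ p = no-adjacent {s} {t} {u} {v} ab bc cd da p
  ... | inj₂ bad₁ with ∨⁻ {adjacent t u v s} bad₁
  ... | inj₁ p = no-adjacent {t} {u} {v} {s} bc cd da ab p
  ... | inj₂ bad₂ with ∨⁻ {adjacent u v s t} bad₂
  ... | inj₁ p = no-adjacent {u} {v} {s} {t} cd da ab bc p
  ... | inj₂ bad₃ with ∨⁻ {adjacent v s t u} bad₃
  ... | inj₁ p = no-adjacent {v} {s} {t} {u} da ab bc cd p
  -- A rotation by two steps does not change the alternate condition, so two rotations cover all
  -- four.
  ... | inj₂ bad₄ with ∨⁻ {alternate s t u v} bad₄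
  ... | inj₁ p = no-alternate {s} {t} {u} {v} ab bc cd da p
  ... | inj₂ p = no-alternate {t} {u} {v} {s} bc cd da ab p

  no-monochromatic : ∀ d {v v′ w w′} → v ≢ v′ → w ≢ w′ →
                     Sees d v w → Sees d v w′ → Sees d v′ w → Sees d v′ w′ → ⊥
  no-monochromatic (horizontal s) v≢v′ w≢w′ = no-common-K₂₂ (orient-isLine s) (orient-isLine true)
    (Apart-orient s true (apart v≢v′)) (Apart-orient s true (apart w≢w′))
  no-monochromatic (vertical s) v≢v′ w≢w′ = no-common-K₂₂ (orient-isLine s) (orient-isLine true)
    (Apart-orient s true (Apart-swap (apart v≢v′))) (Apart-orient s true (Apart-swap (apart w≢w′)))

  no-badSquare : ∀ {a b c d v v′ w w′} → v ≢ v′ → w ≢ w′ →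
                 Sees a v w → Sees b v′ w → Sees c v w′ → Sees d v′ w′ → ¬ T (badSquare a b c d)
  no-badSquare {a} {b} {c} {d} v≢v′ w≢w′ vw v′w vw′ v′w′ bad
    with ∨⁻ {a == b ∧ a == c ∧ a == d} bad
  ... | inj₂ cyc = no-cyclic {a} {opposite b} {d} {opposite c}
    vw (sees-back b v′w) v′w′ (sees-back c vw′) cyc
  ... | inj₁ mono with ∧⁻ {a == b} mono
  ... | ab , rest with ∧⁻ {a == c} rest
  ... | ac , ad with ==⇒≡ {a} {b} ab | ==⇒≡ {a} {c} ac | ==⇒≡ {a} {d} ad
  ... | refl | refl | refl = no-monochromatic a v≢v′ w≢w′ vw vw′ v′w v′w′

  -- Without `p ≢ w` the square `p` itself would serve as `w`.
  no-tripod-of-squares : ∀ d e {p q w} → T (d ⊥ᵇ e) → p ≢ w →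
    ∀ {i j k} → i ≢ j → i ≢ k → j ≢ k →
    Sees d p i → Sees d p j → Sees d p k → Sees e q i → Sees e q j → Sees e q k →
    Sees (opposite e) w i ⊎ Sees d w i → Sees (opposite e) w j ⊎ Sees d w j →
    Sees (opposite e) w k ⊎ Sees d w k → ⊥
  no-tripod-of-squares (vertical t) (horizontal s) _ p≢w ij ik jk pi pj pk qi qj qk wi wj wk =
    no-three-seen s t (apart p≢w) (seen pi qi wi) (seen pj qj wj) (seen pk qk wk)
      (apart ij) (apart ik) (apart jk)
  no-tripod-of-squares (horizontal t) (vertical s) _ p≢w ij ik jk pi pj pk qi qj qk wi wj wk =
    no-three-seen s t (Apart-swap (apart p≢w)) (seen pi qi wi) (seen pj qj wj) (seen pk qk wk)
      (Apart-swap (apart ij)) (Apart-swap (apart ik)) (Apart-swap (apart jk))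
  no-tripod-of-squares (horizontal _) (horizontal _) ()
  no-tripod-of-squares (vertical _)   (vertical _)   ()

  Observes : ∀ {m} → (Fin m → V) → (Fin m → Direction) → V → Set₁
  Observes v d w = ∀ i → Sees (d i) (v i) w

  module _ {m} {v : Fin m → V} (v-injective : Injective _≡_ _≡_ v) where

    no-clash : ∀ {c d w w′} → w ≢ w′ → Observes v (lookup c) w → Observes v (lookup d) w′ →
               ¬ T (clash c d)
    no-clash {c} {d} {w} {w′} w≢w′ oc od bad =
      let i , j , i≢j , t = anyPair⁻ {p = badPair} (Vec.zip c d) bad in
      no-badSquare (i≢j ∘ v-injective) w≢w′ (oc i) (oc j) (od i) (od j)
        (subst₂ (λ ac bd → T (badPair ac bd)) (lookup-zip i c d) (lookup-zip j c d) t)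

    third-sees : ∀ {d e s} {u w : V} → T (third d e s) → Sees s u w →
                 Sees (opposite e) u w ⊎ Sees d u w
    third-sees {d} {e} {s} t sees with ∨⁻ {s == d} t
    ... | inj₁ s==d = inj₂ (subst (λ z → Sees z _ _) (==⇒≡ {s} {d} s==d) sees)
    ... | inj₂ s==e = inj₁ (subst (λ z → Sees z _ _) (==⇒≡ {s} {opposite e} s==e) sees)

    no-tripod-observed : ∀ {x y z w₁ w₂ w₃} → w₁ ≢ w₂ → w₁ ≢ w₃ → w₂ ≢ w₃ →
                         Observes v x w₁ → Observes v y w₂ → Observes v z w₃ → ¬ T (tripod x y z)
    no-tripod-observed {x} {y} {z} {w₁} {w₂} {w₃} w₁₂ w₁₃ w₂₃ ox oy oz bad =
      let p , bad-p = anyFin⁻ bad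
          const-p , bad-q′ = ∧⁻ bad-p
          xp=yp , xp=zp = ∧⁻ const-p
          q , bad-q = anyFin⁻ bad-q′
          hyp-q , bad-r′ = ∧⁻ bad-q
          p⊥q , const-q = ∧⁻ hyp-q
          xq=yq , xq=zq = ∧⁻ const-q
          r , bad-r = anyFin⁻ bad-r′
          p≢r , thirds = ∧⁻ {not ⌊ p Fin.≟ r ⌋} bad-r
          third-x , thirds′ = ∧⁻ thirds
          third-y , third-z = ∧⁻ thirds′
      in no-tripod-of-squares (x p) (x q) p⊥q (toWitnessFalse p≢r ∘ v-injective) w₁₂ w₁₃ w₂₃
        (ox p) (recolour (==⇒≡ xp=yp) (oy p)) (recolour (==⇒≡ xp=zp) (oz p))
        (ox q) (recolour (==⇒≡ xq=yq) (oy q)) (recolour (==⇒≡ xq=zq) (oz q))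
        (third-sees third-x (ox r)) (third-sees third-y (oy r)) (third-sees third-z (oz r))
      where
      recolour : ∀ {d e u w} → d ≡ e → Sees e u w → Sees d u w
      recolour refl s = s

  module _ {m} {v : Fin m → V} (v-injective : Injective _≡_ _≡_ v) where

    no-rowTripod : ∀ {k} {cs : Vec (Column m) k} {ws : Vec V k} → Unique ws →
                   (∀ i → Observes v (lookup (lookup cs i)) (lookup ws i)) → ¬ T (rowTripod cs)
    no-rowTripod {k} {cs} {ws} ws-unique obs bad =
      let i , j , l , i≢j , i≢l , j≢l , t = anyTriple⁻ (Vec.allFin m) bad in
      no-tripod-observed (lookup-injective ws-unique _ _)
        (i≢j ∘ v-injective) (i≢l ∘ v-injective) (j≢l ∘ v-injective)
        (view i) (view j) (view l)
        (relabel (lookup-allFin i) (lookup-allFin j) (lookup-allFin l) t)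
      where
      view : ∀ i → Observes (lookup ws) (row cs i) (v i)
      view i k = sees-back (lookup (lookup cs k) i) (obs k i)
      relabel : ∀ {i i′ j j′ l l′} → i ≡ i′ → j ≡ j′ → l ≡ l′ →
                T (tripod (row cs i) (row cs j) (row cs l)) →
                T (tripod (row cs i′) (row cs j′) (row cs l′))
      relabel refl refl refl t = t

    no-columnTripod : ∀ {k c w} {cs : Vec (Column m) k} {ws : Vec V k} → Unique (w ∷ ws) →
                      Observes v (lookup c) w →
                      (∀ i → Observes v (lookup (lookup cs i)) (lookup ws i)) →
                      ¬ T (columnTripod c cs)
    no-columnTripod {cs = cs} (w∉ws ∷ ws-unique) oc obs bad =
      let i , j , i≢j , t = anyPair⁻ cs bad in
      no-tripod-observed v-injective (VAll.lookup⁺ w∉ws i) (VAll.lookup⁺ w∉ws j)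
        (i≢j ∘ lookup-injective ws-unique i j) oc (obs i) (obs j) t

    -- The invariant is that `cands` contains every column which a square outside `ws` can have. The
    -- true column of the next square is then one of the branches of the search. It exists only up
    -- to double negation, which suffices for refuting.
    refuted-sound : ∀ {n k} (us : Vec V n) {ws : Vec V k} {cs : Vec (Column m) k} {cands} →
      Unique us → VAll.All (λ u → VAll.All (u ≢_) ws) us → Unique ws →
      (∀ i → Observes v (lookup (lookup cs i)) (lookup ws i)) →
      (∀ u c → VAll.All (u ≢_) ws → Observes v (lookup c) u → c ∈ cands) →
      (∀ u → u VMem.∈ us → ¬ ¬ (∃[ c ] Observes v (lookup c) u)) →
      ¬ T (refuted n cs cands)
    refuted-sound [] {cs = cs} _ _ ws-unique obs _ _ = no-rowTripod {cs = cs} ws-unique obs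
    refuted-sound {suc n} (u ∷ us) {ws} {cs} {cands} (u∉us ∷ us-unique) (u∉ws ∷ us∉ws) ws-unique
                  obs complete watched bad =
      watched u (VAny.here refl) λ (c , oc) → continue c oc
        (∨⁻ (All.lookup (All.all⁺ _ cands bad) (complete u c u∉ws oc)))
      where
      continue : ∀ c → Observes v (lookup c) u →
                 T (columnTripod c cs) ⊎
                 T (refuted n (c ∷ cs) (filterᵇ (λ d → not (clash c d)) cands)) → ⊥
      continue c oc (inj₁ t) = no-columnTripod {c = c} {cs = cs} (u∉ws ∷ ws-unique) oc obs t
      continue c oc (inj₂ t) = refuted-sound us {cs = c ∷ cs} us-unique
        (VAll.map (λ (u≢u′ , u′∉ws) → ≢-sym u≢u′ ∷ u′∉ws) (VAll.zip (u∉us , us∉ws)))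
        (u∉ws ∷ ws-unique)
        (λ { zero → oc ; (suc i) → obs i })
        -- Filtering keeps the invariant: a column that clashes with `c` cannot belong to a square
        -- other than `u`.
        (λ { u′ d (u′≢u ∷ u′∉ws) od →
               ∈-filter⁺ (T? ∘ (λ d → not (clash c d))) (complete u′ d u′∉ws od)
               (¬T⇒Tnot (no-clash v-injective {c} {d} (≢-sym u′≢u) oc od)) })
        (λ u′ u′∈us → watched u′ (VAny.there u′∈us)) t
        where
        ¬T⇒Tnot : ∀ {b} → ¬ T b → T (not b)
        ¬T⇒Tnot {true}  h = h tt
        ¬T⇒Tnot {false} _ = tt

  -- Double negation commutes with finite conjunctions.
  choose : ∀ {m} (P : Fin m → Direction → Set₁) → (∀ i → ¬ ¬ ∃ (P i)) →
           ¬ ¬ (∃[ c ] (∀ i → P i (lookup c i)))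
  choose {zero}  P ex h = h ([] , λ ())
  choose {suc m} P ex h = ex zero λ (d , p) → choose (P ∘ suc) (ex ∘ suc) λ (c , ps) →
    h (d ∷ c , λ { zero → p ; (suc i) → ps i })

  no-bipartite : ∀ {m n} → refuted n [] (columns m) ≡ true →
                 {v : Fin m → V} {w : Fin n → V} → Injective _≡_ _≡_ v → Injective _≡_ _≡_ w →
                 ¬ (∀ i k → ¬ ¬ (∃[ d ] Sees d (v i) (w k)))
  no-bipartite {m} eq {v} {w} v-injective w-injective sees =
    refuted-sound v-injective (Vec.tabulate w) {[]} {[]} (tabulate⁺ w-injective)
      (VAll.lookup⁻ λ _ → []) [] (λ ()) (λ _ c _ _ → columns-complete c)
      (λ u u∈w → watched (VAny.tabulate⁻ u∈w))
      (Equivalence.from T-≡ eq)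
    where
    watched : ∀ {u} → (∃[ k ] (u ≡ w k)) → ¬ ¬ (∃[ c ] Observes v (lookup c) u)
    watched (k , refl) = choose (λ i d → Sees d (v i) (w k)) (λ i → sees i k)

-- The search is run by the type checker, over 64 columns of length 3 here and 256 columns of length
-- 4 below.
refuted-3-5 : refuted 5 [] (columns 3) ≡ true
refuted-3-5 = refl

refuted-4-4 : refuted 4 [] (columns 4) ≡ true
refuted-4-4 = refl

-- From representations to tables

visible⇒sees : ∀ {V : Set} (S : V → UnitSquare) (dis : DisjointInteriors S) {v w} →
               v ≢ w → Visible S v w →
               ¬ ¬ (∃[ d ] Scene.Sees (left ∘ S) (bottom ∘ S) (disjoint⇒apart S dis) d v w)
visible⇒sees S dis v≢w (inj₁ band) h = band⇒sights S dis v≢w band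
  (λ s → h (horizontal true , s)) (λ s → h (horizontal false , backwards s))
visible⇒sees S dis v≢w (inj₂ band) h =
  band⇒sights (transpose ∘ S) (DisjointInteriors-transpose {S = S} dis) v≢w band
  (λ s → h (vertical true , s)) (λ s → h (vertical false , backwards s))

K-not-weakURVG : ∀ m′ n′ {m n} → refuted n′ [] (columns m′) ≡ true → m′ ≤ m → n′ ≤ n →
                 ¬ IsWeakURVG (K m n)
K-not-weakURVG m′ n′ eq m′≤m n′≤n (S , dis , visible) =
  Scene.no-bipartite (left ∘ S) (bottom ∘ S) (disjoint⇒apart S dis) eq
    -- The table is read off from the first `m′` and `n′` vertices of the two sides, while all
    -- squares of the representation are kept.
    {inj₁ ∘ λ i → inject≤ i m′≤m} {inj₂ ∘ λ k → inject≤ k n′≤n}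
    (λ e → inject≤-injective m′≤m m′≤m _ _ (inj₁-injective e))
    (λ e → inject≤-injective n′≤n n′≤n _ _ (inj₂-injective e))
    (λ i k → visible⇒sees S dis (λ ()) (visible _ _ tt))

theorem5p5 : (m n : ℕ) → 0 < m → 0 < n → m ≤ n → (4 ≤ m × 4 ≤ n) ⊎ (3 ≤ m × 5 ≤ n) → ¬ IsWeakURVG (K m n)
theorem5p5 m n _ _ _ (inj₁ (4≤m , 4≤n)) = K-not-weakURVG 4 4 refuted-4-4 4≤m 4≤n
theorem5p5 m n _ _ _ (inj₂ (3≤m , 5≤n)) = K-not-weakURVG 3 5 refuted-3-5 3≤m 5≤n
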